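{- For any integers $c,d\ge 2$ we have \[ \phi\left(n,\,c(d+1),\,\binom{c(d+1)}{2} - dc + (d+1) \right) = \Omega\left(n^{1+\frac{1}{d}}\right), \] where the constant implicit in the $\Omega$-notation depends only on $c$ and $d$.
   Context: For a finite point set $\mathcal P\subset\mathbb R^2$, the number of distinct distances it determines is $|\{|pq| : p,q\in\mathcal P,\ p\neq q\}|$, where $|pq|$ is the Euclidean distance. For positive integers $n,k,l$, $\phi(n,k,l)$ denotes the minimum number of distinct distances determined by a set $\mathcal P$ of $n$ points in $\mathbb R^2$ with the property that every $k$ points of $\mathcal P$ determine at least $l$ distinct distances. -}

module Defs where

open import Level using (0ℓ)
open import Data.Nat as ℕ using (ℕ)
open import Data.Fin using (Fin)
open import Data.Product using (Σ; ∃; _×_; _,_)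
open import Data.Sum using (_⊎_)
open import Relation.Nullary using (¬_)
open import Relation.Binary.PropositionalEquality using (_≡_)
open import Function.Definitions using (Injective)
open import Algebra.Structures using (IsCommutativeRing)

-- A Dedekind-complete ordered field (a model of the real numbers ℝ;
-- unique up to isomorphism).
record RealField : Set₁ where
  infixl 6 _+_
  infixl 7 _*_
  infix 4 _<_ _≤_
  field
    Carrier : Set
    0# 1# : Carrier
    _+_ _*_ : Carrier → Carrier → Carrier
    -_ : Carrier → Carrier
    _<_ : Carrier → Carrier → Set
    isCommutativeRing : IsCommutativeRing _≡_ _+_ _*_ -_ 0# 1#
    0≢1 : ¬ (0# ≡ 1#)
    *-inverse : ∀ x → ¬ (x ≡ 0#) → ∃ λ y → x * y ≡ 1#
    <-irrefl : ∀ x → ¬ (x < x)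
    <-trans : ∀ {x y z} → x < y → y < z → x < z
    <-trichotomy : ∀ x y → x < y ⊎ (x ≡ y ⊎ y < x)
    +-mono-< : ∀ {x y} z → x < y → x + z < y + z
    *-pos : ∀ {x y} → 0# < x → 0# < y → 0# < x * y

  _≤_ : Carrier → Carrier → Set
  x ≤ y = x < y ⊎ x ≡ y

  IsUpperBound : (Carrier → Set) → Carrier → Set
  IsUpperBound S b = ∀ x → S x → x ≤ b

  field
    completeness : (S : Carrier → Set) → ∃ S → ∃ (IsUpperBound S) →
                   ∃ λ s → IsUpperBound S s × (∀ b → IsUpperBound S b → s ≤ b)

module Geometry (ℝ : RealField) where
  open RealField ℝ

  Point : Set
  Point = Carrier × Carrier

  _-ᵣ_ : Carrier → Carrier → Carrier
  x -ᵣ y = x + (- y)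

  sqDist : Point → Point → Carrier
  sqDist (x₁ , y₁) (x₂ , y₂) =
    (x₁ -ᵣ x₂) * (x₁ -ᵣ x₂) + (y₁ -ᵣ y₂) * (y₁ -ᵣ y₂)

  -- The points pts : Fin n → Point determine at least m distinct distances:
  -- there are m pairs (i , j) with i ≢ j whose distances are pairwise
  -- distinct.  (Distances are compared via their squares, which is
  -- equivalent since distances are non-negative.)
  AtLeastDistinct : {n : ℕ} → (Fin n → Point) → ℕ → Set
  AtLeastDistinct {n} pts m =
    Σ (Fin m → Fin n × Fin n) λ f →
      (∀ t → let (i , j) = f t in ¬ (i ≡ j)) ×
      Injective _≡_ _≡_ (λ t → let (i , j) = f t in sqDist (pts i) (pts j))

  EveryKDetermineL : {n : ℕ} → (Fin n → Point) → ℕ → ℕ → Set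
  EveryKDetermineL {n} pts k l =
    (g : Fin k → Fin n) → Injective _≡_ _≡_ g →
    AtLeastDistinct (λ t → pts (g t)) l

{-# OPTIONS --safe #-}
module Submission where

open import Defs
open import Level using (0ℓ)
open import Data.Nat using (ℕ; zero; suc; _+_; _*_; _∸_; _^_; _≤_; _/_; NonZero; >-nonZero; z≤n; s≤s; _≤?_)
open import Data.Nat.Properties
open import Data.Nat.Combinatorics using (_C_; nCk+nC[k+1]≡[n+1]C[k+1]; nC1≡n)
open import Data.Nat.DivMod using (m/n*n≤m; m≡m%n+[m/n]*n; m%n<n)
open import Data.Nat.ListAction using (sum)
open import Data.Nat.Solver using (module +-*-Solver)
open import Data.Fin as Fin using (Fin; zero; suc)
import Data.Fin.Properties as Fin
open import Data.List
  using (List; []; _∷_; _++_; [_]; length; map; filter; take; lookup; allFin; tabulate; deduplicate; cartesianProductWith)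
open import Data.List.Properties
  using (length-++; length-map; length-take; length-tabulate; length-deduplicate; ++-assoc)
open import Data.List.Membership.Propositional using (_∈_; _∉_)
open import Data.List.Membership.Propositional.Properties
  using (∈-++⁺ˡ; ∈-++⁺ʳ; ∈-++⁻; ∈-map⁺; ∈-map⁻; ∈-∃++; ∈-filter⁺; ∈-filter⁻; ∈-lookup; ∈-allFin; ∈-tabulate⁻;
         ∈-cartesianProductWith⁺; ∈-cartesianProductWith⁻; ∈-deduplicate⁺; ∈-deduplicate⁻)
import Data.List.Membership.DecPropositional as DecMembership
open import Data.List.Relation.Unary.Any using (here; there)
import Data.List.Relation.Unary.All as All
open import Data.List.Relation.Unary.AllPairs using ([]; _∷_)
open import Data.List.Relation.Unary.Unique.Propositional using (Unique)
import Data.List.Relation.Unary.Unique.Propositional.Properties as Unique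
import Data.List.Relation.Unary.Unique.DecPropositional.Properties as DecUnique
open import Data.List.Relation.Binary.Subset.Propositional using (_⊆_)
open import Data.List.Relation.Binary.Permutation.Propositional using (_↭_; prep; ↭-refl; ↭-trans; ↭⇒↭ₛ)
open import Data.List.Relation.Binary.Permutation.Propositional.Properties using (∈-resp-↭; ↭-length; shift)
import Data.List.Relation.Binary.Permutation.Setoid.Properties as SetoidPermutation
open import Data.Product using (∃; ∃₂; _×_; _,_; proj₁; proj₂; uncurry)
open import Data.Sum as Sum using (_⊎_; inj₁; inj₂)
open import Data.Empty using (⊥; ⊥-elim)
open import Function using (_∘_; id)
open import Function.Definitions using (Injective)
open import Relation.Nullary using (Dec; yes; no; ¬?; contradiction)
open import Relation.Nullary.Decidable using (_×-dec_)
open import Relation.Unary using (Pred; Decidable)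
open import Relation.Binary.Definitions using (DecidableEquality)
open import Relation.Binary.PropositionalEquality
  using (_≡_; _≢_; refl; sym; trans; cong; cong₂; subst; subst₂; setoid; module ≡-Reasoning)
open import Algebra.Bundles using (CommutativeRing)
open import Algebra.Properties.CommutativeSemigroup +-commutativeSemigroup using (x∙yz≈y∙xz; interchange)
import Algebra.Properties.CommutativeSemigroup *-commutativeSemigroup as *
import Algebra.Properties.Ring as RingProperties

-- No vertex is joined to more than k = c (d + 1) others in one colour (distance),
-- since k - 1 equal edges at a vertex already cost too many colours; so every vertex
-- sees at least (n - 1) / k colours.
-- If d + 1 vertices had many common colours, choosing c - 1 of them and, for each,
-- one edge of that colour at every one of the d + 1 vertices would give a set of at
-- most c (d + 1) vertices in which (c - 1) (d + 1) edges have only c - 1 colours,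
-- one colour too few.  Hence d + 1 vertices have boundedly many common colours, and
-- Kővári–Sós–Turán double counting of the vertex–colour incidences bounds the
-- number of colours from below.

-- Finite sets as duplicate-free lists.

module _ {A : Set} where

  -- Provides the complement `zs` of `xs` in `ys`. The head `x` is cut out of `ys`; the tail still
  -- embeds in what is left because `x` does not recur in it.
  unique-⊆⇒↭ : ∀ {xs ys : List A} → Unique xs → xs ⊆ ys → ∃ λ zs → ys ↭ xs ++ zs
  unique-⊆⇒↭ {[]} {ys} _ _ = ys , ↭-refl
  unique-⊆⇒↭ {x ∷ xs} {ys} (x∉ ∷ xs!) sub with ∈-∃++ (sub (here refl))
  ... | us , vs , refl = zs , ↭-trans (shift x us vs) (prep x perm)
    where
    sub′ : xs ⊆ us ++ vs
    sub′ z∈ with ∈-resp-↭ (shift x us vs) (sub (there z∈))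
    ... | here refl = contradiction refl (All.lookup x∉ z∈)
    ... | there z∈′ = z∈′
    ih = unique-⊆⇒↭ xs! sub′
    zs = proj₁ ih
    perm = proj₂ ih

  unique-⊆⇒length-≤ : ∀ {xs ys : List A} → Unique xs → xs ⊆ ys → length xs ≤ length ys
  unique-⊆⇒length-≤ {xs} {ys} xs! sub with zs , perm ← unique-⊆⇒↭ xs! sub = begin
    length xs             ≤⟨ m≤m+n _ _ ⟩
    length xs + length zs ≡⟨ length-++ xs ⟨
    length (xs ++ zs)     ≡⟨ ↭-length perm ⟨
    length ys             ∎
    where open ≤-Reasoning

  lookup-injective : ∀ {xs : List A} → Unique xs → Injective _≡_ _≡_ (lookup xs)
  lookup-injective {x ∷ xs} _ {zero} {zero} _ = refl
  lookup-injective {x ∷ xs} (x∉ ∷ _) {zero} {suc j} eq = contradiction eq (All.lookup x∉ (∈-lookup j))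
  lookup-injective {x ∷ xs} (x∉ ∷ _) {suc i} {zero} eq = contradiction (sym eq) (All.lookup x∉ (∈-lookup i))
  lookup-injective {x ∷ xs} (_ ∷ xs!) {suc i} {suc j} eq = cong suc (lookup-injective xs! eq)

  -- The edges of the complete graph on a duplicate-free `xs`, in one orientation only, the earlier
  -- vertex first.
  pairs : List A → List (A × A)
  pairs []       = []
  pairs (x ∷ xs) = map (x ,_) xs ++ pairs xs

  length-pairs : ∀ xs → length (pairs xs) ≡ length xs C 2
  length-pairs [] = refl
  length-pairs (x ∷ xs) = begin
    length (map (x ,_) xs ++ pairs xs)         ≡⟨ length-++ (map (x ,_) xs) ⟩
    length (map (x ,_) xs) + length (pairs xs) ≡⟨ cong₂ _+_ (length-map (x ,_) xs) (length-pairs xs) ⟩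
    length xs + length xs C 2                  ≡⟨ cong (_+ length xs C 2) (nC1≡n (length xs)) ⟨
    length xs C 1 + length xs C 2              ≡⟨ nCk+nC[k+1]≡[n+1]C[k+1] (length xs) 1 ⟩
    suc (length xs) C 2                        ∎
    where open ≡-Reasoning

  pairs-complete : ∀ {xs x y} → x ∈ xs → y ∈ xs → x ≢ y → (x , y) ∈ pairs xs ⊎ (y , x) ∈ pairs xs
  pairs-complete (here refl) (here refl) x≢y = contradiction refl x≢y
  pairs-complete (here refl) (there y∈) _ = inj₁ (∈-++⁺ˡ (∈-map⁺ _ y∈))
  pairs-complete (there x∈) (here refl) _ = inj₂ (∈-++⁺ˡ (∈-map⁺ _ x∈))
  pairs-complete {z ∷ zs} (there x∈) (there y∈) x≢y =
    Sum.map (∈-++⁺ʳ _) (∈-++⁺ʳ _) (pairs-complete x∈ y∈ x≢y)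

  pairs-irreflexive : ∀ {xs x y} → Unique xs → (x , y) ∈ pairs xs → x ≢ y
  pairs-irreflexive {z ∷ zs} (z∉ ∷ zs!) xy∈ with ∈-++⁻ (map (z ,_) zs) xy∈
  ... | inj₂ xy∈′ = pairs-irreflexive zs! xy∈′
  ... | inj₁ xy∈′ with _ , y∈ , refl ← ∈-map⁻ _ xy∈′ = All.lookup z∉ y∈

  ∈-pairs-++ : ∀ {xs ys x y} → x ∈ xs → y ∈ ys → (x , y) ∈ pairs (xs ++ ys)
  ∈-pairs-++ {x ∷ xs} (here refl) y∈ = ∈-++⁺ˡ (∈-map⁺ _ (∈-++⁺ʳ xs y∈))
  ∈-pairs-++ {x ∷ xs} (there x∈) y∈ = ∈-++⁺ʳ _ (∈-pairs-++ x∈ y∈)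

  length-filter-split : ∀ {P : Pred A 0ℓ} (P? : Decidable P) xs →
    length (filter P? xs) + length (filter (¬? ∘ P?) xs) ≡ length xs
  length-filter-split P? [] = refl
  length-filter-split P? (x ∷ xs) with P? x
  ... | yes _ = cong suc (length-filter-split P? xs)
  ... | no _  = trans (+-suc _ _) (cong suc (length-filter-split P? xs))

  take-⊆ : ∀ m {xs : List A} → take m xs ⊆ xs
  take-⊆ (suc m) {x ∷ xs} (here eq) = here eq
  take-⊆ (suc m) {x ∷ xs} (there z∈) = there (take-⊆ m z∈)

  length-take-≤ : ∀ {m} {xs : List A} → m ≤ length xs → length (take m xs) ≡ m
  length-take-≤ {m} {xs} m≤ = trans (length-take m xs) (m≤n⇒m⊓n≡m m≤)

  take-++ : ∀ xs {ys : List A} m → take (length xs + m) (xs ++ ys) ≡ xs ++ take m ys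
  take-++ []       m = refl
  take-++ (x ∷ xs) m = cong (x ∷_) (take-++ xs m)

  -- Pads a vertex set to exactly `k` elements, since the local property speaks only of sets of that
  -- size. The padding is a prefix of the complement of `xs` in `us`.
  extend : ∀ {k} {xs us : List A} → Unique xs → Unique us → xs ⊆ us →
    length xs ≤ k → k ≤ length us → ∃ λ ys → Unique (xs ++ ys) × length (xs ++ ys) ≡ k
  extend {k} {xs} {us} xs! us! xs⊆us xs≤k k≤us with zs , perm ← unique-⊆⇒↭ xs! xs⊆us =
    take (k ∸ length xs) zs ,
    subst Unique prefix (Unique.take⁺ k (Unique-resp-↭ (↭⇒↭ₛ perm) us!)) ,
    trans (cong length (sym prefix)) (length-take-≤ (≤-trans k≤us (≤-reflexive (↭-length perm))))
    where
    open SetoidPermutation (setoid A) using (Unique-resp-↭)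
    prefix : take k (xs ++ zs) ≡ xs ++ take (k ∸ length xs) zs
    prefix = trans (cong (λ m → take m (xs ++ zs)) (sym (m+[n∸m]≡n xs≤k))) (take-++ xs _)

  length-cartesianProductWith : ∀ {B C : Set} (f : A → B → C) xs ys →
    length (cartesianProductWith f xs ys) ≡ length xs * length ys
  length-cartesianProductWith f []       ys = refl
  length-cartesianProductWith f (x ∷ xs) ys = trans (length-++ (map (f x) ys))
    (cong₂ _+_ (length-map (f x) ys) (length-cartesianProductWith f xs ys))

module _ {A B : Set} (_≟_ : DecidableEquality B) (f : A → B) where

  -- Induction on `ys` peels off the fibre over `y`. The hypothesis on fibres quantifies over all
  -- duplicate-free `zs ⊆ xs` so that it passes to the filtered list.
  fibres-bound : ∀ {K} xs ys → Unique xs → (∀ {x} → x ∈ xs → f x ∈ ys) →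
    (∀ {zs} y → Unique zs → zs ⊆ xs → (∀ {z} → z ∈ zs → f z ≡ y) → length zs ≤ K) →
    length xs ≤ length ys * K
  fibres-bound [] [] _ _ _ = z≤n
  fibres-bound (x ∷ xs) [] _ into _ with () ← into (here refl)
  fibres-bound {K} xs (y ∷ ys) xs! into bound = begin
    length xs                                              ≡⟨ length-filter-split y? xs ⟨
    length (filter y? xs) + length (filter (¬? ∘ y?) xs)   ≤⟨ +-mono-≤
      (bound y (Unique.filter⁺ y? xs!) (proj₁ ∘ ∈-filter⁻ y?) (proj₂ ∘ ∈-filter⁻ y? {xs = xs}))
      (fibres-bound _ ys (Unique.filter⁺ (¬? ∘ y?) xs!) into′
        (λ z zs! zs⊆ → bound z zs! (proj₁ ∘ ∈-filter⁻ (¬? ∘ y?) ∘ zs⊆))) ⟩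
    K + length ys * K                                      ∎
    where
    open ≤-Reasoning
    y? = λ x → f x ≟ y
    into′ : ∀ {x} → x ∈ filter (¬? ∘ y?) xs → f x ∈ ys
    into′ x∈ with x∈xs , fx≢y ← ∈-filter⁻ (¬? ∘ y?) {xs = xs} x∈ | into x∈xs
    ... | here fx≡y = contradiction fx≡y fx≢y
    ... | there fx∈ = fx∈

-- Estimates for binomial coefficients.

C-suc : ∀ n k → suc n C suc k ≡ n C k + n C suc k
C-suc n k = sym (nCk+nC[k+1]≡[n+1]C[k+1] n k)

C-monoˡ-≤ : ∀ k {m n} → m ≤ n → m C k ≤ n C k
C-monoˡ-≤ zero          _   = ≤-refl
C-monoˡ-≤ (suc k) {n = n}   z≤n = z≤n
C-monoˡ-≤ (suc k) {suc m} {suc n} (s≤s m≤n) = subst₂ _≤_ (sym (C-suc m k)) (sym (C-suc n k))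
  (+-mono-≤ (C-monoˡ-≤ k m≤n) (C-monoˡ-≤ (suc k) m≤n))

C≤^ : ∀ n k → n C k ≤ n ^ k
C≤^ n zero = ≤-refl
C≤^ zero (suc k) = z≤n
C≤^ (suc n) (suc k) = begin
  suc n C suc k       ≡⟨ C-suc n k ⟩
  n C k + n C suc k   ≤⟨ +-mono-≤ (C≤^ n k) (C≤^ n (suc k)) ⟩
  suc n * n ^ k       ≤⟨ *-monoʳ-≤ (suc n) (^-monoˡ-≤ k (n≤1+n n)) ⟩
  suc n * suc n ^ k   ∎
  where open ≤-Reasoning

-- Convexity of C(t, d + 1) in t, standing in for Jensen's inequality: the line of slope C(T, d)
-- through zero at T lies below it. Up to `T` the last summand suffices; past `T` each step of `t`
-- raises the right side by C(t, d) ≥ C(T, d).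
C-tangent : ∀ d T t → t * (T C d) ≤ t C suc d + T * (T C d)
C-tangent d T zero = z≤n
C-tangent d T (suc t) with suc t ≤? T
... | yes t<T = m≤n⇒m≤o+n _ (*-monoˡ-≤ (T C d) t<T)
... | no t≮T = begin
  T C d + t * (T C d)                   ≤⟨ +-mono-≤ (C-monoˡ-≤ d (≮⇒≥ t≮T)) (C-tangent d T t) ⟩
  t C d + (t C suc d + T * (T C d))     ≡⟨ +-assoc (t C d) _ _ ⟨
  t C d + t C suc d + T * (T C d)       ≡⟨ cong (_+ T * (T C d)) (C-suc t d) ⟨
  suc t C suc d + T * (T C d)           ∎
  where open ≤-Reasoning

-- The tangent at d q, evaluated at q + d q, gives q C(d q, d) ≤ C((d + 1) q, d + 1) after
-- cancelling; induction on d does the rest.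
^≤C : ∀ d q → q ^ d ≤ (d * q) C d
^≤C zero q = ≤-refl
^≤C (suc d) q = ≤-trans (*-monoʳ-≤ q (^≤C d q)) (+-cancelʳ-≤ (d * q * (d * q C d)) _ _
  (subst (_≤ (q + d * q) C suc d + d * q * (d * q C d)) (*-distribʳ-+ (d * q C d) q (d * q))
    (C-tangent d (d * q) (q + d * q))))

-- Double counting of incidences (Kővári-Sós-Turán).

module Incidence {V J : Set} {R : V → J → Set} (R? : ∀ v j → Dec (R v j)) where

  degree : List V → J → ℕ
  degree vs j = length (filter (λ v → R? v j) vs)

  -- The new `v` raises the degree of precisely the `j` related to it, and for those Pascal's rule
  -- splits off the first sum.
  sum-degree-∷ : ∀ d v vs js → sum (map (λ j → degree (v ∷ vs) j C suc d) js) ≡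
    sum (map (λ j → degree vs j C d) (filter (R? v) js)) + sum (map (λ j → degree vs j C suc d) js)
  sum-degree-∷ d v vs [] = refl
  sum-degree-∷ d v vs (j ∷ js) with R? v j
  ... | yes _ = trans (cong₂ _+_ (C-suc (degree vs j) d) (sum-degree-∷ d v vs js))
    (interchange (degree vs j C d) (degree vs j C suc d) (sum (map (λ j → degree vs j C d) (filter (R? v) js))) _)
  ... | no _ = trans (cong (degree vs j C suc d +_) (sum-degree-∷ d v vs js))
    (x∙yz≈y∙xz (degree vs j C suc d) (sum (map (λ j → degree vs j C d) (filter (R? v) js))) _)

  -- The left side counts the pairs of a d-subset of `vs` and a common neighbour in `js`. No subsets
  -- are enumerated: those containing `v` are handled with d lowered by one and `js` cut down to the
  -- neighbours of `v`, the others by dropping `v`.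
  sum-degree-C-≤ : ∀ {D} d vs js → Unique vs → Unique js →
    (∀ {as bs} → Unique as → as ⊆ vs → length as ≡ d → Unique bs → bs ⊆ js →
      (∀ {a b} → a ∈ as → b ∈ bs → R a b) → length bs ≤ D) →
    sum (map (λ j → degree vs j C d) js) ≤ D * (length vs C d)
  sum-degree-C-≤ {D} zero vs js vs! js! H = begin
    sum (map (λ j → degree vs j C 0) js)  ≡⟨ sum-ones js ⟩
    length js                             ≤⟨ H [] (λ ()) refl js! id (λ ()) ⟩
    D                                     ≡⟨ *-identityʳ D ⟨
    D * 1                                 ∎
    where
    open ≤-Reasoning
    sum-ones : ∀ js → sum (map (λ j → degree vs j C 0) js) ≡ length js
    sum-ones [] = refl
    sum-ones (j ∷ js) = cong suc (sum-ones js)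
  sum-degree-C-≤ {D} (suc d) [] js vs! js! H = ≤-trans (≤-reflexive (sum-zeros js)) z≤n
    where
    sum-zeros : ∀ js → sum (map (λ j → degree [] j C suc d) js) ≡ 0
    sum-zeros [] = refl
    sum-zeros (j ∷ js) = sum-zeros js
  sum-degree-C-≤ {D} (suc d) (v ∷ vs) js (v∉ ∷ vs!) js! H = begin
    sum (map (λ j → degree (v ∷ vs) j C suc d) js)            ≡⟨ sum-degree-∷ d v vs js ⟩
    sum (map (λ j → degree vs j C d) (filter (R? v) js)) + sum (map (λ j → degree vs j C suc d) js)
      ≤⟨ +-mono-≤ (sum-degree-C-≤ d vs (filter (R? v) js) vs! (Unique.filter⁺ (R? v) js!) H-with)
                  (sum-degree-C-≤ (suc d) vs js vs! js! (λ as! as⊆ → H as! (there ∘ as⊆))) ⟩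
    D * (length vs C d) + D * (length vs C suc d)             ≡⟨ *-distribˡ-+ D _ _ ⟨
    D * (length vs C d + length vs C suc d)                   ≡⟨ cong (D *_) (C-suc (length vs) d) ⟨
    D * (suc (length vs) C suc d)                             ∎
    where
    open ≤-Reasoning
    H-with : ∀ {as bs} → Unique as → as ⊆ vs → length as ≡ d → Unique bs → bs ⊆ filter (R? v) js →
      (∀ {a b} → a ∈ as → b ∈ bs → R a b) → length bs ≤ D
    H-with {as} {bs} as! as⊆ len bs! bs⊆ Rab =
      H (All.tabulate (All.lookup v∉ ∘ as⊆) ∷ as!) sub (cong suc len) bs!
        (proj₁ ∘ ∈-filter⁻ (R? v) ∘ bs⊆) rel
      where
      sub : v ∷ as ⊆ v ∷ vs
      sub (here eq) = here eq
      sub (there a∈) = there (as⊆ a∈)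
      rel : ∀ {a b} → a ∈ v ∷ as → b ∈ bs → R a b
      rel (here refl) b∈ = proj₂ (∈-filter⁻ (R? v) {xs = js} (bs⊆ b∈))
      rel (there a∈)  b∈ = Rab a∈ b∈

  -- The incidences counted from the vertices; the factor `k` stays on the right to avoid dividing
  -- by it.
  sum-degree-≥ : ∀ {p k} vs js → (∀ v → p ≤ length (filter (R? v) js) * k) →
    length vs * p ≤ sum (map (degree vs) js) * k
  sum-degree-≥ [] js _ = z≤n
  sum-degree-≥ {p} {k} (v ∷ vs) js rows = begin
    p + length vs * p
      ≤⟨ +-mono-≤ (rows v) (sum-degree-≥ vs js rows) ⟩
    length (filter (R? v) js) * k + sum (map (degree vs) js) * k
      ≡⟨ *-distribʳ-+ k (length (filter (R? v) js)) _ ⟨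
    (length (filter (R? v) js) + sum (map (degree vs) js)) * k
      ≡⟨ cong (_* k) (split js) ⟩
    sum (map (degree (v ∷ vs)) js) * k ∎
    where
    open ≤-Reasoning
    split : ∀ js → length (filter (R? v) js) + sum (map (degree vs) js) ≡ sum (map (degree (v ∷ vs)) js)
    split [] = refl
    split (j ∷ js) with R? v j
    ... | yes _ = cong suc (trans (x∙yz≈y∙xz (length (filter (R? v) js)) (degree vs j) _)
      (cong (degree vs j +_) (split js)))
    ... | no _ = trans (x∙yz≈y∙xz (length (filter (R? v) js)) (degree vs j) _)
      (cong (degree vs j +_) (split js))

  sum-degree-tangent : ∀ d T vs js → sum (map (degree vs) js) * (T C d) ≤
    sum (map (λ j → degree vs j C suc d) js) + length js * T * (T C d)
  sum-degree-tangent d T vs [] = z≤n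
  sum-degree-tangent d T vs (j ∷ js) = begin
    (degree vs j + sum (map (degree vs) js)) * (T C d)
      ≡⟨ *-distribʳ-+ (T C d) (degree vs j) _ ⟩
    degree vs j * (T C d) + sum (map (degree vs) js) * (T C d)
      ≤⟨ +-mono-≤ (C-tangent d T (degree vs j)) (sum-degree-tangent d T vs js) ⟩
    degree vs j C suc d + T * (T C d) + (_ + length js * T * (T C d))
      ≡⟨ solve 5 (λ a T X b m → (a :+ T :* X) :+ (b :+ m :* T :* X) := (a :+ b) :+ (T :+ m :* T) :* X)
           refl (degree vs j C suc d) T (T C d) _ (length js) ⟩
    _ ∎
    where
    open ≤-Reasoning
    open +-*-Solver

-- From the tangent inequality to a power bound.

^-distribʳ-* : ∀ a b k → (a * b) ^ k ≡ a ^ k * b ^ k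
^-distribʳ-* a b zero = refl
^-distribʳ-* a b (suc k) = trans (cong (a * b *_) (^-distribʳ-* a b k)) (*.interchange a b (a ^ k) (b ^ k))

-- The tangent bound is used at T = d q, where T C d ≥ q ^ d, with q chosen so that
-- S ≥ 2 m T and hence half of S survives.
tangent⇒power-bound : ∀ {k d D m S p} → 1 ≤ k → 1 ≤ d → 1 ≤ D → 1 ≤ p → 1 ≤ m →
  suc p * p ≤ S * k →
  (∀ T → S * (T C d) ≤ D * (suc p C suc d) + m * T * (T C d)) →
  suc p ^ suc d ≤ (8 * (k * d)) ^ suc d * D * m ^ d
tangent⇒power-bound {k} {d} {D} {m} {S} {p} 1≤k 1≤d 1≤D 1≤p 1≤m np≤Sk tangent = go q refl
  where
  open ≤-Reasoning
  open +-*-Solver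
  n = suc p
  B = 8 * (k * d)
  -- With this `M`, q M = 2 m T k, so q M ≤ n p ≤ S k yields 2 m T ≤ S.
  M = 2 * (k * d * m)
  1≤M : 1 ≤ M
  1≤M = *-mono-≤ {1} {2} (s≤s z≤n) (*-mono-≤ (*-mono-≤ 1≤k 1≤d) 1≤m)
  instance
    k≢0 : NonZero k
    k≢0 = >-nonZero 1≤k
    d≢0 : NonZero d
    d≢0 = >-nonZero 1≤d
    D≢0 : NonZero D
    D≢0 = >-nonZero 1≤D
    m≢0 : NonZero m
    m≢0 = >-nonZero 1≤m
    M≢0 : NonZero M
    M≢0 = >-nonZero 1≤M
    n^≢0 : NonZero (n ^ suc d)
    n^≢0 = m^n≢0 n (suc d)
    B≢0 : NonZero B
    B≢0 = >-nonZero (*-mono-≤ {1} {8} (s≤s z≤n) (*-mono-≤ 1≤k 1≤d))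
    B^≢0 : NonZero (B ^ d)
    B^≢0 = m^n≢0 B d
  q = n * p / M
  T = d * q
  n²≤ : n * n ≤ 2 * (n * p)
  n²≤ = begin
    n * n       ≤⟨ *-monoʳ-≤ n (+-monoˡ-≤ p 1≤p) ⟩
    n * (p + p) ≡⟨ solve 2 (λ n p → n :* (p :+ p) := con 2 :* (n :* p)) refl n p ⟩
    2 * (n * p) ∎
  n²≤M : n * n ≤ 2 * (suc q * M)
  -- Rounding down loses less than one `M`: n p < (q + 1) M.
  n²≤M = ≤-trans n²≤ (*-monoʳ-≤ 2 (≤-trans (≤-reflexive (m≡m%n+[m/n]*n (n * p) M))
    (+-monoˡ-≤ (q * M) (<⇒≤ (m%n<n (n * p) M)))))
  2mT≤S : 2 * (m * T) ≤ S
  2mT≤S = *-cancelʳ-≤ _ _ k (begin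
    2 * (m * (d * q)) * k
      ≡⟨ solve 4 (λ m d q k → con 2 :* (m :* (d :* q)) :* k := q :* (con 2 :* (k :* d :* m))) refl m d q k ⟩
    q * M                 ≤⟨ m/n*n≤m (n * p) M ⟩
    n * p                 ≤⟨ np≤Sk ⟩
    S * k                 ∎)
  mTC≤ : m * T * (T C d) ≤ D * n ^ suc d
  mTC≤ = +-cancelʳ-≤ (m * T * (T C d)) _ _ (begin
    m * T * (T C d) + m * T * (T C d)
      ≡⟨ solve 2 (λ x X → x :* X :+ x :* X := con 2 :* x :* X) refl (m * T) (T C d) ⟩
    2 * (m * T) * (T C d)             ≤⟨ *-monoˡ-≤ (T C d) 2mT≤S ⟩
    S * (T C d)                       ≤⟨ tangent T ⟩
    D * (n C suc d) + m * T * (T C d) ≤⟨ +-monoˡ-≤ _ (*-monoʳ-≤ D (C≤^ n (suc d))) ⟩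
    D * n ^ suc d + m * T * (T C d)   ∎)
  mq^≤ : m * q ^ suc d ≤ D * n ^ suc d
  mq^≤ = begin
    m * (q * q ^ d)   ≡⟨ *-assoc m q _ ⟨
    m * q * q ^ d     ≤⟨ *-mono-≤ (*-monoʳ-≤ m (m≤n*m q d)) (^≤C d q) ⟩
    m * T * (T C d)   ≤⟨ mTC≤ ⟩
    D * n ^ suc d     ∎
  go : ∀ q′ → q ≡ q′ → n ^ suc d ≤ B ^ suc d * D * m ^ d
  -- For q = 0 the number m is already large, n² ≤ B m, and n^(d+1) ≤ n^(2d) because d ≥ 1.
  go zero q≡0 = begin
    n ^ suc d           ≤⟨ ^-monoʳ-≤ n (+-monoˡ-≤ d 1≤d) ⟩
    n ^ (d + d)         ≡⟨ trans (^-distribˡ-+-* n d d) (sym (^-distribʳ-* n n d)) ⟩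
    (n * n) ^ d         ≤⟨ ^-monoˡ-≤ d n²≤Bm ⟩
    (B * m) ^ d         ≡⟨ ^-distribʳ-* B m d ⟩
    B ^ d * m ^ d       ≤⟨ *-monoˡ-≤ (m ^ d) (≤-trans (m≤n*m (B ^ d) B) (m≤m*n (B ^ suc d) D)) ⟩
    B ^ suc d * D * m ^ d ∎
    where
    n²≤Bm : n * n ≤ B * m
    n²≤Bm = begin
      n * n                   ≤⟨ n²≤M ⟩
      2 * (suc q * M)         ≡⟨ cong (λ q → 2 * (suc q * M)) q≡0 ⟩
      2 * (1 * M)
        ≡⟨ solve 2 (λ x m → con 2 :* (con 1 :* (con 2 :* (x :* m))) := con 4 :* (x :* m)) refl (k * d) m ⟩
      4 * (k * d * m)         ≤⟨ *-monoˡ-≤ (k * d * m) (m≤m+n 4 4) ⟩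
      8 * (k * d * m)         ≡⟨ *-assoc 8 (k * d) m ⟨
      B * m                   ∎
  -- For q ≥ 1, q + 1 ≤ 2 q gives n² ≤ B m q. In its (d + 1)-st power the factor m q^(d+1) is at
  -- most D n^(d+1), and one n^(d+1) cancels.
  go (suc q′) q≡ = *-cancelʳ-≤ _ _ (n ^ suc d) (begin
    n ^ suc d * n ^ suc d                      ≡⟨ ^-distribʳ-* n n (suc d) ⟨
    (n * n) ^ suc d                            ≤⟨ ^-monoˡ-≤ (suc d) n²≤Bmq ⟩
    (B * (m * q)) ^ suc d
      ≡⟨ trans (^-distribʳ-* B (m * q) (suc d)) (cong (B ^ suc d *_) (^-distribʳ-* m q (suc d))) ⟩
    B ^ suc d * (m ^ suc d * q ^ suc d)
      ≡⟨ solve 4 (λ b m x y → b :* ((m :* x) :* y) := b :* x :* (m :* y)) refl (B ^ suc d) m (m ^ d) (q ^ suc d) ⟩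
    B ^ suc d * m ^ d * (m * q ^ suc d)        ≤⟨ *-monoʳ-≤ (B ^ suc d * m ^ d) mq^≤ ⟩
    B ^ suc d * m ^ d * (D * n ^ suc d)
      ≡⟨ solve 4 (λ b x D y → b :* x :* (D :* y) := b :* D :* x :* y) refl (B ^ suc d) (m ^ d) D (n ^ suc d) ⟩
    B ^ suc d * D * m ^ d * n ^ suc d          ∎)
    where
    n²≤Bmq : n * n ≤ B * (m * q)
    n²≤Bmq = begin
      n * n                    ≤⟨ n²≤M ⟩
      2 * (suc q * M)
        ≤⟨ *-monoʳ-≤ 2 (*-monoˡ-≤ M (+-monoˡ-≤ q (subst (1 ≤_) (sym q≡) (s≤s z≤n)))) ⟩
      2 * ((q + q) * M)
        ≡⟨ solve 3 (λ q x m → con 2 :* ((q :+ q) :* (con 2 :* (x :* m))) := con 8 :* x :* (m :* q)) refl q (k * d) m ⟩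
      B * (m * q)              ∎

-- Edge colourings of a complete graph and the local property.

module Colouring {A : Set} (_≟_ : DecidableEquality A) {n : ℕ} (col : Fin n → Fin n → A) where

  open DecMembership _≟_ using (_∈?_)

  edge-col : Fin n × Fin n → A
  edge-col = uncurry col

  -- Pairs outside `E` contribute at most one colour each, pairs in `E` only colours of `X`.
  few-colours : ∀ {L E X cs} → Unique E → E ⊆ pairs L → (∀ {e} → e ∈ E → edge-col e ∈ X) →
    Unique cs → cs ⊆ map edge-col (pairs L) → length cs + length E ≤ length L C 2 + length X
  few-colours {L} {E} {X} {cs} E! E⊆ E-in-X cs! cs⊆ with rest , perm ← unique-⊆⇒↭ E! E⊆ = begin
    length cs + length E                           ≤⟨ +-monoˡ-≤ (length E) (unique-⊆⇒length-≤ cs! cs⊆′) ⟩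
    length (X ++ map edge-col rest) + length E
      ≡⟨ cong (_+ length E) (trans (length-++ X) (cong (length X +_) (length-map edge-col rest))) ⟩
    length X + length rest + length E
      ≡⟨ solve 3 (λ x r e → x :+ r :+ e := (e :+ r) :+ x) refl (length X) (length rest) (length E) ⟩
    length E + length rest + length X
      ≡⟨ cong (_+ length X) (trans (sym (length-++ E)) (sym (↭-length perm))) ⟩
    length (pairs L) + length X                    ≡⟨ cong (_+ length X) (length-pairs L) ⟩
    length L C 2 + length X                        ∎
    where
    open ≤-Reasoning
    open +-*-Solver
    cs⊆′ : cs ⊆ X ++ map edge-col rest
    cs⊆′ c∈ with e , e∈ , refl ← ∈-map⁻ edge-col (cs⊆ c∈) | ∈-++⁻ E (∈-resp-↭ perm e∈)
    ... | inj₁ e∈E = ∈-++⁺ˡ (E-in-X e∈E)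
    ... | inj₂ e∈r = ∈-++⁺ʳ X (∈-map⁺ edge-col e∈r)

  -- The vertex-colour incidence to be double counted. `w ≢ v` excludes the diagonal value
  -- `col v v`, which belongs to no edge.
  Sees : Fin n → A → Set
  Sees v δ = ∃ λ w → w ≢ v × col v w ≡ δ

  sees? : ∀ v δ → Dec (Sees v δ)
  sees? v δ = Fin.any? λ w → ¬? (w Fin.≟ v) ×-dec (col v w ≟ δ)

  colours : List A
  colours = deduplicate _≟_ (map edge-col (pairs (allFin n)))

  colours-! : Unique colours
  colours-! = DecUnique.deduplicate-! _≟_ _

  -- Here c is `suc c′`, and the term d c of the threshold stands on the right of `local` in place
  -- of a truncated subtraction.
  module LocalProperty (col-sym : ∀ v w → col v w ≡ col w v) (c′ d : ℕ) (1≤d : 1 ≤ d)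
    (k≤n : suc c′ * suc d ≤ n)
    (local : ∀ {L} → Unique L → length L ≡ suc c′ * suc d →
      ∃ λ cs → Unique cs × cs ⊆ map edge-col (pairs L) ×
        (suc c′ * suc d) C 2 + suc d ≤ length cs + d * suc c′) where

    k : ℕ
    k = suc c′ * suc d

    -- Source of both contradictions below: `E` saves at least |E| - |X| colours in a set of k
    -- vertices, while the local property tolerates a saving of d c - (d + 1) only.
    local-bound : ∀ {L E X} → Unique L → length L ≡ k → Unique E → E ⊆ pairs L →
      (∀ {e} → e ∈ E → edge-col e ∈ X) → suc d + length E ≤ d * suc c′ + length X
    local-bound {L} {E} {X} L! len E! E⊆ E-in-X with cs , cs! , cs⊆ , many ← local L! len =
      +-cancelˡ-≤ (k C 2) _ _ (begin
        k C 2 + (suc d + length E)             ≡⟨ +-assoc (k C 2) _ _ ⟨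
        k C 2 + suc d + length E               ≤⟨ +-monoˡ-≤ (length E) many ⟩
        length cs + d * suc c′ + length E
          ≡⟨ solve 3 (λ a b c → a :+ b :+ c := a :+ c :+ b) refl (length cs) (d * suc c′) _ ⟩
        length cs + length E + d * suc c′
          ≤⟨ +-monoˡ-≤ (d * suc c′) (few-colours {L} E! E⊆ E-in-X cs! cs⊆) ⟩
        length L C 2 + length X + d * suc c′   ≡⟨ cong (λ l → l C 2 + length X + d * suc c′) len ⟩
        k C 2 + length X + d * suc c′
          ≡⟨ solve 3 (λ a b c → a :+ b :+ c := a :+ (c :+ b)) refl (k C 2) (length X) _ ⟩
        k C 2 + (d * suc c′ + length X)        ∎)
      where
      open ≤-Reasoning
      open +-*-Solver

    -- A star of k - 1 edges in one colour fills a set of k vertices and saves k - 2 colours, more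
    -- than d c - (d + 1) since k = d c + c.
    colour-degree : ∀ v {ws} δ → Unique ws → v ∉ ws → (∀ {w} → w ∈ ws → col v w ≡ δ) → length ws ≤ k
    colour-degree v {ws} δ ws! v∉ mono with length ws ≤? k
    ... | yes ws≤k = ws≤k
    ... | no ws≰k = contradiction bound (<⇒≱ (begin-strict
        d * suc c′ + 1                  <⟨ m<m+n _ 1≤d ⟩
        d * suc c′ + 1 + d              ≤⟨ m≤m+n _ c′ ⟩
        d * suc c′ + 1 + d + c′
          ≡⟨ solve 2 (λ d c → d :* (con 1 :+ c) :+ con 1 :+ d :+ c := con 1 :+ (d :+ c :* (con 1 :+ d)) :+ d) refl d c′ ⟩
        k + d                           ≡⟨ solve 2 (λ d k → con 1 :+ k :+ d := con 1 :+ d :+ k) refl d k-1 ⟩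
        suc d + k-1                     ≡⟨ cong (suc d +_) (sym len-E) ⟩
        suc d + length E                ∎))
      where
      open ≤-Reasoning
      open +-*-Solver
      -- Spelled out so that `suc k-1` is `k` by computation.
      k-1 = d + c′ * suc d
      ws′ = take k-1 ws
      len-ws′ : length ws′ ≡ k-1
      len-ws′ = length-take-≤ (≤-trans (n≤1+n k-1) (<⇒≤ (≰⇒> ws≰k)))
      E = map (v ,_) ws′
      len-E : length E ≡ k-1
      len-E = trans (length-map (v ,_) ws′) len-ws′
      mono′ : ∀ {e} → e ∈ E → edge-col e ∈ [ δ ]
      mono′ e∈ with w , w∈ , refl ← ∈-map⁻ (v ,_) e∈ = here (mono (take-⊆ k-1 w∈))
      bound : suc d + length E ≤ d * suc c′ + 1
      bound = local-bound {v ∷ ws′}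
        (All.tabulate (λ w∈ v≡w → v∉ (subst (_∈ ws) (sym v≡w) (take-⊆ k-1 w∈))) ∷ Unique.take⁺ k-1 ws!)
        (cong suc len-ws′) (Unique.map⁺ (cong proj₂) (Unique.take⁺ k-1 ws!)) ∈-++⁺ˡ mono′

    -- `col v` sends the n - 1 other vertices to colours seen by `v`, with fibres bounded by
    -- `colour-degree`.
    sees-many : ∀ v → n ∸ 1 ≤ length (filter (sees? v) colours) * k
    sees-many v = begin
      n ∸ 1          ≤⟨ ∸-monoˡ-≤ 1 n≤ ⟩
      length others  ≤⟨ fibres-bound _≟_ (col v) others _ (Unique.filter⁺ ≢v? (Unique.allFin⁺ n)) seen
                          (λ δ zs! zs⊆ →
                            colour-degree v δ zs! (λ v∈ → proj₂ (∈-filter⁻ ≢v? {xs = allFin n} (zs⊆ v∈)) refl)) ⟩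
      length (filter (sees? v) colours) * k ∎
      where
      open ≤-Reasoning
      ≢v? = λ w → ¬? (w Fin.≟ v)
      others = filter ≢v? (allFin n)
      n≤ : n ≤ suc (length others)
      n≤ = subst (_≤ suc (length others)) (length-tabulate {n = n} id) (unique-⊆⇒length-≤ (Unique.allFin⁺ n) cover)
        where
        cover : allFin n ⊆ v ∷ others
        cover {w} w∈ with w Fin.≟ v
        ... | yes w≡v = here w≡v
        ... | no w≢v = there (∈-filter⁺ ≢v? w∈ w≢v)
      seen : ∀ {w} → w ∈ others → col v w ∈ filter (sees? v) colours
      seen {w} w∈ = ∈-filter⁺ (sees? v) (∈-deduplicate⁺ _≟_ col∈) (w , w≢v , refl)
        where
        w≢v = proj₂ (∈-filter⁻ ≢v? {xs = allFin n} w∈)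
        col∈ : col v w ∈ map edge-col (pairs (allFin n))
        col∈ with pairs-complete (∈-allFin v) (∈-allFin w) (w≢v ∘ sym)
        ... | inj₁ vw∈ = ∈-map⁺ edge-col vw∈
        ... | inj₂ wv∈ = subst (_∈ map edge-col (pairs (allFin n))) (col-sym w v) (∈-map⁺ edge-col wv∈)

    -- The c′ (d + 1) star edges have only c′ colours and, with at most one leaf per edge, span at
    -- most k vertices. They save c′ d = d c - d colours, exactly one more than is tolerated.
    no-common-star : ∀ {as Ds} → Unique as → length as ≡ suc d → Unique Ds → length Ds ≡ c′ →
      (∀ {a δ} → a ∈ as → δ ∈ Ds → ∃ λ b → b ∉ as × col a b ≡ δ) → ⊥
    no-common-star {as} {Ds} as! len-as Ds! len-Ds star =
      contradiction (local-bound {X = Ds} L! len-L E! E⊆ E-in-Ds) (<⇒≱ (begin-strict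
        d * suc c′ + length Ds          ≡⟨ cong (d * suc c′ +_) len-Ds ⟩
        d * suc c′ + c′                 <⟨ n<1+n _ ⟩
        suc (d * suc c′ + c′)
          ≡⟨ solve 2 (λ d c → con 1 :+ (d :* (con 1 :+ c) :+ c) := con 1 :+ d :+ c :* (con 1 :+ d)) refl d c′ ⟩
        suc d + c′ * suc d              ≡⟨ cong (suc d +_) (sym (len-product edge)) ⟩
        suc d + length E                ∎))
      where
      open ≤-Reasoning
      open +-*-Solver
      I = allFin (length as)
      S = allFin (length Ds)
      star-at : ∀ s i → ∃ λ b → b ∉ as × col (lookup as i) b ≡ lookup Ds s
      star-at s i = star (∈-lookup i) (∈-lookup s)
      leaf : Fin (length Ds) → Fin (length as) → Fin n
      leaf s i = proj₁ (star-at s i)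
      edge : Fin (length Ds) → Fin (length as) → Fin n × Fin n
      edge s i = lookup as i , leaf s i
      E = cartesianProductWith edge S I
      len-product : ∀ {B : Set} (f : Fin (length Ds) → Fin (length as) → B) →
        length (cartesianProductWith f S I) ≡ c′ * suc d
      len-product f = trans (length-cartesianProductWith f S I)
        (cong₂ _*_ (trans (length-tabulate {n = length Ds} id) len-Ds)
          (trans (length-tabulate {n = length as} id) len-as))
      leaves = deduplicate Fin._≟_ (cartesianProductWith leaf S I)
      leaf∈ : ∀ s i → leaf s i ∈ leaves
      leaf∈ s i = ∈-deduplicate⁺ Fin._≟_ (∈-cartesianProductWith⁺ leaf (∈-allFin s) (∈-allFin i))
      leaves∉ : ∀ {b} → b ∈ leaves → b ∉ as
      leaves∉ b∈ with s , i , _ , _ , refl ← ∈-cartesianProductWith⁻ leaf S I (∈-deduplicate⁻ Fin._≟_ _ b∈) =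
        proj₁ (proj₂ (star-at s i))
      base! : Unique (as ++ leaves)
      base! = Unique.++⁺ as! (DecUnique.deduplicate-! Fin._≟_ _) (λ (a∈ , b∈) → leaves∉ b∈ a∈)
      base≤k : length (as ++ leaves) ≤ k
      base≤k = begin
        length (as ++ leaves)       ≡⟨ length-++ as ⟩
        length as + length leaves   ≤⟨ +-mono-≤ (≤-reflexive len-as)
          (≤-trans (length-deduplicate Fin._≟_ (cartesianProductWith leaf S I)) (≤-reflexive (len-product leaf))) ⟩
        k                           ∎
      E! : Unique E
      -- Leaves may coincide, but an edge determines its end in `as`, and its colour determines the
      -- entry of `Ds`.
      E! = Unique.cartesianProductWith⁺ edge edge-inj (Unique.allFin⁺ _) (Unique.allFin⁺ _)
        where
        edge-inj : ∀ {s t i j} → edge s i ≡ edge t j → s ≡ t × i ≡ j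
        edge-inj {s} {t} {i} {j} eq = lookup-injective Ds! δ-eq , lookup-injective as! (cong proj₁ eq)
          where
          δ-eq = trans (sym (proj₂ (proj₂ (star-at s i)))) (trans (cong edge-col eq) (proj₂ (proj₂ (star-at t j))))
      -- Coinciding leaves may leave fewer than k vertices, hence the padding.
      extension = extend {k = k} base! (Unique.allFin⁺ n) (λ {v} _ → ∈-allFin v) base≤k
        (≤-trans k≤n (≤-reflexive (sym (length-tabulate {n = n} id))))
      zs = proj₁ extension
      L! = proj₁ (proj₂ extension)
      len-L = proj₂ (proj₂ extension)
      -- `as` precedes `leaves` in the list, so `pairs` holds these edges in the orientation that
      -- `edge` gives them.
      E⊆ : E ⊆ pairs ((as ++ leaves) ++ zs)
      E⊆ e∈ with s , i , _ , _ , refl ← ∈-cartesianProductWith⁻ edge S I e∈ =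
        subst (λ L → edge s i ∈ pairs L) (sym (++-assoc as leaves zs))
          (∈-pairs-++ {xs = as} (∈-lookup i) (∈-++⁺ˡ (leaf∈ s i)))
      E-in-Ds : ∀ {e} → e ∈ E → edge-col e ∈ Ds
      E-in-Ds e∈ with s , i , _ , _ , refl ← ∈-cartesianProductWith⁻ edge S I e∈ =
        subst (_∈ Ds) (sym (proj₂ (proj₂ (star-at s i)))) (∈-lookup s)

    -- At most (d + 1)² colours occur within `as`. Any other common colour is seen by each `a`
    -- through a vertex outside `as`, so c′ of these would form the star just excluded.
    common-colours-bound : ∀ {as js} → Unique as → length as ≡ suc d → Unique js →
      (∀ {a δ} → a ∈ as → δ ∈ js → Sees a δ) → length js ≤ suc d * suc d + c′
    common-colours-bound {as} {js} as! len-as js! sees = begin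
      length js                          ≤⟨ unique-⊆⇒length-≤ js! cover ⟩
      length (inner ++ outer)            ≡⟨ length-++ inner ⟩
      length inner + length outer        ≤⟨ +-mono-≤
        (≤-reflexive (trans (length-cartesianProductWith col as as) (cong₂ _*_ len-as len-as))) outer≤ ⟩
      suc d * suc d + c′                 ∎
      where
      open ≤-Reasoning
      inner = cartesianProductWith col as as
      outer? = λ δ → ¬? (δ ∈? inner)
      outer = filter outer? js
      cover : js ⊆ inner ++ outer
      cover {δ} δ∈ with δ ∈? inner
      ... | yes δ∈inner = ∈-++⁺ˡ δ∈inner
      ... | no δ∉inner = ∈-++⁺ʳ inner (∈-filter⁺ outer? δ∈ δ∉inner)
      outer≤ : length outer ≤ c′
      outer≤ with length outer ≤? c′
      ... | yes le = le
      ... | no gt = ⊥-elim (no-common-star as! len-as (Unique.take⁺ c′ (Unique.filter⁺ outer? js!))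
          (length-take-≤ (<⇒≤ (≰⇒> gt))) star)
        where
        star : ∀ {a δ} → a ∈ as → δ ∈ take c′ outer → ∃ λ b → b ∉ as × col a b ≡ δ
        star {a} a∈ δ∈ with δ∈js , δ∉inner ← ∈-filter⁻ outer? {xs = js} (take-⊆ c′ δ∈)
                     with b , _ , refl ← sees a∈ δ∈js =
          b , (λ b∈ → δ∉inner (∈-cartesianProductWith⁺ col a∈ b∈)) , refl

    -- The vertices give at least n (n - 1) / k incidences, while the bound `D` on common colours of
    -- d + 1 vertices limits the sum of C(deg, d + 1) over the colours; convexity plays these
    -- against each other.
    many-colours : 2 ≤ n → n ^ suc d ≤ (8 * (k * d)) ^ suc d * (suc d * suc d + c′) * length colours ^ d
    many-colours 2≤n = subst (λ n → n ^ suc d ≤ (8 * (k * d)) ^ suc d * D * length colours ^ d) suc-p≡n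
      (tangent⇒power-bound {k = k} {S = total} (s≤s z≤n) 1≤d (s≤s z≤n) 1≤p colours≥1
        (subst (λ m → m * p ≤ total * k) (trans (length-tabulate {n = n} id) (sym suc-p≡n))
          (sum-degree-≥ (allFin n) colours sees-many))
        tangent)
      where
      open Incidence sees?
      D = suc d * suc d + c′
      p = n ∸ 1
      suc-p≡n : suc p ≡ n
      suc-p≡n = m+[n∸m]≡n (≤-trans (n≤1+n 1) 2≤n)
      1≤p : 1 ≤ p
      1≤p = ∸-monoˡ-≤ 1 2≤n
      total = sum (map (degree (allFin n)) colours)
      colours≥1 : 1 ≤ length colours
      colours≥1 with colours | sees-many (Fin.fromℕ< 2≤n)
      ... | [] | p≤0 = contradiction (≤-trans 1≤p p≤0) λ ()
      ... | _ ∷ _ | _ = s≤s z≤n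
      tangent : ∀ T → total * (T C d) ≤ D * (suc p C suc d) + length colours * T * (T C d)
      tangent T = ≤-trans (sum-degree-tangent d T (allFin n) colours) (+-monoˡ-≤ _ (begin
        sum (map (λ j → degree (allFin n) j C suc d) colours)
          ≤⟨ sum-degree-C-≤ (suc d) (allFin n) colours (Unique.allFin⁺ n) colours-!
               (λ as! _ len-as js! _ → common-colours-bound as! len-as js!) ⟩
        D * (length (allFin n) C suc d)
          ≡⟨ cong (λ m → D * (m C suc d)) (trans (length-tabulate {n = n} id) (sym suc-p≡n)) ⟩
        D * (suc p C suc d) ∎))
        where open ≤-Reasoning

-- Distances in the plane as colours.

module _ (ℝ : RealField) where
  open RealField ℝ using (Carrier)
  open Geometry ℝ

  private
    ring : CommutativeRing _ _
    ring = record { isCommutativeRing = RealField.isCommutativeRing ℝ }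
    module ℝ = CommutativeRing ring
  open RingProperties ℝ.ring using (-‿distribˡ-*; -‿distribʳ-*; -‿involutive; -‿+-comm)

  -- Trichotomy is a disjunction open to case analysis, so it decides equality; deduplicating
  -- colours relies on this.
  _≟ᵣ_ : DecidableEquality Carrier
  x ≟ᵣ y with RealField.<-trichotomy ℝ x y
  ... | inj₁ x<y         = no λ { refl → RealField.<-irrefl ℝ x x<y }
  ... | inj₂ (inj₁ x≡y)  = yes x≡y
  ... | inj₂ (inj₂ y<x)  = no λ { refl → RealField.<-irrefl ℝ x y<x }

  square-diff-comm : ∀ x y → (x -ᵣ y) ℝ.* (x -ᵣ y) ≡ (y -ᵣ x) ℝ.* (y -ᵣ x)
  square-diff-comm x y = begin
    (x -ᵣ y) ℝ.* (x -ᵣ y)               ≡⟨ cong₂ ℝ._*_ flip flip ⟩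
    (ℝ.- (y -ᵣ x)) ℝ.* (ℝ.- (y -ᵣ x))   ≡⟨ -‿distribˡ-* _ _ ⟨
    ℝ.- ((y -ᵣ x) ℝ.* (ℝ.- (y -ᵣ x)))   ≡⟨ cong ℝ.-_ (sym (-‿distribʳ-* _ _)) ⟩
    ℝ.- (ℝ.- ((y -ᵣ x) ℝ.* (y -ᵣ x)))   ≡⟨ -‿involutive _ ⟩
    (y -ᵣ x) ℝ.* (y -ᵣ x)               ∎
    where
    open ≡-Reasoning
    flip : x -ᵣ y ≡ ℝ.- (y -ᵣ x)
    flip = begin
      x ℝ.+ ℝ.- y              ≡⟨ ℝ.+-comm _ _ ⟩
      ℝ.- y ℝ.+ x              ≡⟨ cong (ℝ.- y ℝ.+_) (sym (-‿involutive x)) ⟩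
      ℝ.- y ℝ.+ ℝ.- (ℝ.- x)    ≡⟨ -‿+-comm y (ℝ.- x) ⟩
      ℝ.- (y -ᵣ x)             ∎

  sqDist-comm : ∀ p q → sqDist p q ≡ sqDist q p
  sqDist-comm (x₁ , y₁) (x₂ , y₂) = cong₂ ℝ._+_ (square-diff-comm x₁ x₂) (square-diff-comm y₁ y₂)

  module _ {n : ℕ} (pts : Fin n → Point) where

    dist : Fin n → Fin n → Carrier
    dist i j = sqDist (pts i) (pts j)

    open Colouring _≟ᵣ_ dist

    -- `f` may orient a pair against the order of `L`; symmetry of the distance repairs this.
    atLeast⇒colours : ∀ {L l} → Unique L → AtLeastDistinct (pts ∘ lookup L) l →
      ∃ λ cs → Unique cs × cs ⊆ map edge-col (pairs L) × length cs ≡ l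
    atLeast⇒colours {L} {l} L! (f , f-irr , f-inj) =
      tabulate value , Unique.tabulate⁺ f-inj , sub , length-tabulate value
      where
      value : Fin l → Carrier
      value t = dist (lookup L (proj₁ (f t))) (lookup L (proj₂ (f t)))
      sub : tabulate value ⊆ map edge-col (pairs L)
      sub v∈ with t , refl ← ∈-tabulate⁻ v∈
        with pairs-complete (∈-lookup {xs = L} (proj₁ (f t))) (∈-lookup {xs = L} (proj₂ (f t))) (f-irr t ∘ lookup-injective L!)
      ... | inj₁ ij∈ = ∈-map⁺ edge-col ij∈
      ... | inj₂ ji∈ = subst (_∈ map edge-col (pairs L)) (sqDist-comm _ _) (∈-map⁺ edge-col ji∈)

    colours⇒atLeast : AtLeastDistinct pts (length colours)
    colours⇒atLeast = (λ t → proj₁ (source t)) ,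
      (λ t → pairs-irreflexive (Unique.allFin⁺ n) (proj₁ (proj₂ (source t)))) ,
      (λ {s} {t} eq → lookup-injective colours-!
        (trans (proj₂ (proj₂ (source s))) (trans eq (sym (proj₂ (proj₂ (source t)))))))
      where
      source : ∀ t → ∃ λ e → e ∈ pairs (allFin n) × lookup colours t ≡ edge-col e
      source t = ∈-map⁻ edge-col (∈-deduplicate⁻ _≟ᵣ_ _ (∈-lookup t))

-- Raising the bound to the d-th power clears the exponent 1 + 1/d. `N` and `n₀` are fixed before n
-- and the points.
theorem1p1 : (ℝ : RealField) → (c d : ℕ) → 2 ≤ c → 2 ≤ d →
    ∃₂ λ (N n₀ : ℕ) → 1 ≤ N ×
    ((n : ℕ) → n₀ ≤ n → (pts : Fin n → Geometry.Point ℝ) → Injective _≡_ _≡_ pts →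
    Geometry.EveryKDetermineL ℝ pts (c * (d + 1)) (((c * (d + 1)) C 2) ∸ d * c + (d + 1)) →
    ∃ λ m → Geometry.AtLeastDistinct ℝ pts m × n ^ (d + 1) ≤ N * m ^ d)
theorem1p1 ℝ (suc c′) d _ 2≤d rewrite +-comm d 1 =
  -- `N` is the constant of `many-colours`; `n₀ = k` leaves room for sets of k vertices.
  (8 * (k * d)) ^ suc d * (suc d * suc d + c′) , k , N≥1 , λ n k≤n pts _ every →
    length (Colouring.colours (_≟ᵣ_ ℝ) (dist ℝ pts)) , colours⇒atLeast ℝ pts ,
    Colouring.LocalProperty.many-colours (_≟ᵣ_ ℝ) (dist ℝ pts) (λ v w → sqDist-comm ℝ (pts v) (pts w))
      c′ d 1≤d k≤n (local pts every) (≤-trans 2≤k k≤n)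
  where
  open ≤-Reasoning
  k = suc c′ * suc d
  1≤d : 1 ≤ d
  1≤d = ≤-trans (n≤1+n 1) 2≤d
  2≤k : 2 ≤ k
  2≤k = ≤-trans (s≤s 1≤d) (m≤m+n (suc d) (c′ * suc d))
  N≥1 : 1 ≤ (8 * (k * d)) ^ suc d * (suc d * suc d + c′)
  N≥1 = *-mono-≤
    (≤-trans (≤-reflexive (sym (^-zeroˡ (suc d))))
      (^-monoˡ-≤ (suc d) (*-mono-≤ {1} {8} (s≤s z≤n) (*-mono-≤ {1} {k} (s≤s z≤n) 1≤d))))
    (s≤s z≤n)
  local : ∀ {n} (pts : Fin n → Geometry.Point ℝ) →
    Geometry.EveryKDetermineL ℝ pts k ((k C 2) ∸ d * suc c′ + suc d) →
    ∀ {L} → Unique L → length L ≡ k →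
    ∃ λ cs → Unique cs × cs ⊆ map (uncurry (dist ℝ pts)) (pairs L) × k C 2 + suc d ≤ length cs + d * suc c′
  local pts every {L} L! len with cs , cs! , cs⊆ , len-cs ← atLeast⇒colours ℝ pts L!
    (subst (λ k′ → Geometry.EveryKDetermineL ℝ pts k′ ((k C 2) ∸ d * suc c′ + suc d)) (sym len) every
      (lookup L) (lookup-injective L!)) = cs , cs! , cs⊆ , (begin
    -- The inequality m ≤ n + (m ∸ n) holds also where `∸` truncates.
    k C 2 + suc d                                  ≤⟨ +-monoˡ-≤ (suc d) (m≤n+m∸n (k C 2) (d * suc c′)) ⟩
    d * suc c′ + (k C 2 ∸ d * suc c′) + suc d
      ≡⟨ trans (+-assoc (d * suc c′) _ _) (+-comm (d * suc c′) _) ⟩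
    k C 2 ∸ d * suc c′ + suc d + d * suc c′        ≡⟨ cong (_+ d * suc c′) len-cs ⟨
    length cs + d * suc c′                         ∎)
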